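{- Let $n\geq 4$. Among all connected graphs on $n$ vertices with exactly one pendant vertex, the lollipop graph $U_{n,3}^l$ has the minimum core index.
   Context: All graphs are finite, simple and undirected. A pendant vertex is a vertex of degree one. The lollipop graph $U_{n,3}^l$ is obtained from a triangle $C_3$ and a path on $n-2$ vertices by identifying one end vertex of the path with a vertex of the triangle. A connected subgraph of a graph $G=(V,E)$ is a graph $(V',E')$ with $\emptyset\neq V'\subseteq V$, $E'\subseteq E$, every edge of $E'$ having both endpoints in $V'$, and $(V',E')$ connected; distinct pairs $(V',E')$ are counted separately. The core index $F(G)$ is the number of connected subgraphs of $G$. -}

module Defs where

open import Data.Nat using (ℕ; zero; suc; _≤_; _<_)
open import Data.Bool using (Bool; true; false; _∧_; _∨_; not)
open import Data.Fin using (Fin; toℕ)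
open import Data.Vec using (Vec; lookup; tabulate; map; sum; _∷_; [])
open import Data.List using (List; length)
open import Data.List.Membership.Propositional using (_∈_)
open import Data.List.Relation.Unary.Unique.Propositional using (Unique)
open import Data.Product using (Σ; _×_; ∃; _,_)
open import Relation.Binary.PropositionalEquality using (_≡_; refl)
open import Relation.Nullary using (¬_)
open import Function.Bundles using (_⇔_)

Adj : ℕ → Set
Adj n = Vec (Vec Bool n) n

_[_,_] : ∀ {n} → Adj n → Fin n → Fin n → Bool
A [ u , v ] = lookup (lookup A u) v

Graph : ℕ → Set
Graph = Adj

IsSimple : ∀ {n} → Graph n → Set
IsSimple {n} G = (∀ (u v : Fin n) → G [ u , v ] ≡ G [ v , u ]) × (∀ (u : Fin n) → G [ u , u ] ≡ false)

data Walk {n : ℕ} (A : Adj n) : Fin n → Fin n → Set where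
  here : ∀ {u} → Walk A u u
  step : ∀ {u w v} → A [ u , w ] ≡ true → Walk A w v → Walk A u v

Connected : ∀ {n} → Graph n → Set
Connected {n} G = ∀ (u v : Fin n) → Walk G u v

b2n : Bool → ℕ
b2n true = 1
b2n false = 0

degree : ∀ {n} → Graph n → Fin n → ℕ
degree G u = sum (map b2n (lookup G u))

ExactlyOnePendant : ∀ {n} → Graph n → Set
ExactlyOnePendant {n} G =
  Σ (Fin n) λ p → (degree G p ≡ 1) × (∀ (w : Fin n) → degree G w ≡ 1 → w ≡ p)

-- A candidate subgraph (V', E'): vertex subset and edge set, the latter as a
-- symmetric adjacency matrix.
Sub : ℕ → Set
Sub n = Vec Bool n × Adj n

IsConnSub : ∀ {n} → Graph n → Sub n → Set
IsConnSub {n} G (V , E) =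
  -- E' is a symmetric edge set (so it encodes a set of undirected edges)
  (∀ (u v : Fin n) → E [ u , v ] ≡ E [ v , u ]) ×
  (∀ (u v : Fin n) → E [ u , v ] ≡ true → G [ u , v ] ≡ true) ×
  (∀ (u v : Fin n) → E [ u , v ] ≡ true → (lookup V u ≡ true) × (lookup V v ≡ true)) ×
  (Σ (Fin n) λ u → lookup V u ≡ true) ×
  (∀ (u v : Fin n) → lookup V u ≡ true → lookup V v ≡ true → Walk E u v)

CoreIndex : ∀ {n} → Graph n → ℕ → Set
CoreIndex {n} G k =
  Σ (List (Sub n)) λ L → Unique L × (∀ (s : Sub n) → (s ∈ L) ⇔ IsConnSub G s) × (length L ≡ k)

-- Lollipop U^l_{n,3}: triangle on vertices 0,1,2 and path 2 - 3 - ... - (n-1).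
infix 4 _==_
_==_ : ℕ → ℕ → Bool
zero == zero = true
zero == suc _ = false
suc _ == zero = false
suc a == suc b = a == b

isTri : ℕ → Bool
isTri 0 = true
isTri 1 = true
isTri 2 = true
isTri _ = false

pathStep : ℕ → ℕ → Bool
pathStep i j = (j == suc i) ∧ not (isTri j)

lolAdj : ℕ → ℕ → Bool
lolAdj i j = (isTri i ∧ isTri j ∧ not (i == j)) ∨ pathStep i j ∨ pathStep j i

lollipop : (n : ℕ) → Graph n
lollipop n = tabulate λ i → tabulate λ j → lolAdj (toℕ i) (toℕ j)

_ : lollipop 4 ≡ (false ∷ true ∷ true ∷ false ∷ []) ∷ (true ∷ false ∷ true ∷ false ∷ [])
                 ∷ (true ∷ true ∷ false ∷ true ∷ []) ∷ (false ∷ false ∷ true ∷ false ∷ []) ∷ []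
_ = refl

{-# OPTIONS --safe #-}

-- Both bounds meet at n(n+1)/2 + 4n − 8.
--
-- Lower bound.  A non-backtracking path leaving the pendant vertex closes up to a cycle, and the
-- vertex x at which it does has a neighbour v off the cycle; let y, z be the neighbours of x on the
-- cycle.  Deleting the edge xy leaves a connected graph, which has at least n(n+1)/2 connected
-- subgraphs: growing it vertex by vertex, h vertices carry at least h connected subgraphs through any
-- given vertex, so the next vertex contributes at least h + 1.  The connected subgraphs containing xy
-- number at least 4n − 8: those consisting of xy, an initial piece of the cycle minus x starting at y,
-- and optionally xz and xv account for 4 (h − 2) on the h vertices of the cycle together with v, at
-- least four of them pass through any given vertex, and hence every further vertex contributes four.
--
-- Upper bound.  A connected subgraph of the lollipop containing its last vertex is either that vertex
-- alone or arises by attaching it to a connected subgraph through the previous vertex; the triangle has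
-- 10 connected subgraphs, 7 of which contain a given vertex.
module Submission where

open import Defs
open import Data.Bool using (Bool; true; false; _∧_; _∨_; not)
open import Data.Bool.Properties using (∨-zeroʳ; ¬-not) renaming (_≟_ to _≟ᵇ_)
open import Data.Empty using (⊥-elim)
open import Data.Fin using (Fin; zero; suc; toℕ; fromℕ; fromℕ<; _≟_)
open import Data.Fin.Patterns using (0F; 1F; 2F)
open import Data.Fin.Properties using (all?; ¬∀⟶∃¬; toℕ-injective; toℕ-fromℕ; toℕ-fromℕ<; toℕ<n; toℕ≤pred[n])
open import Data.List using (List; []; _∷_; _++_; length; map; filter)
open import Data.List.Properties using (length-++; length-map; length-tabulate)
open import Data.List.Membership.Propositional using (_∈_; _∉_)
open import Data.List.Membership.Propositional.Properties using (∈-∃++; ∈-++⁻; ∈-++⁺ˡ; ∈-++⁺ʳ; ∈-map⁺; ∈-map⁻; ∈-allFin; ∈-filter⁺)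
import Data.List.Membership.DecPropositional as DecMembership
open import Data.List.Relation.Unary.All as All using (All; []; _∷_)
import Data.List.Relation.Unary.All.Properties as All
open import Data.List.Relation.Unary.AllPairs using ([]; _∷_)
open import Data.List.Relation.Unary.Any using (here; there)
open import Data.List.Relation.Unary.Unique.Propositional using (Unique)
open import Data.List.Relation.Unary.Unique.Propositional.Properties using (allFin⁺) renaming (++⁺ to unique-++)
open import Data.Nat using (ℕ; zero; suc; _+_; _*_; _≤_; _<_; z≤n; s≤s)
open import Data.Nat.Properties using (m≤n+m; 1+n≰n; 1+n≢n; n≤1+n; ≤-pred; ≤∧≢⇒<; suc-injective; *-suc; ≤-refl; ≤-trans; ≤-reflexive; +-mono-≤; +-suc; +-identityʳ; *-distribˡ-+; *-monoˡ-≤; *-monoʳ-≤; *-comm; +-assoc; +-comm; m≤n⇒m≤1+n; <-irrefl; +-cancelʳ-≤; +-monoˡ-≤; +-monoʳ-≤; module ≤-Reasoning)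
open import Data.Nat.Tactic.RingSolver using (solve-∀)
open import Data.Product using (∃; ∃₂; _×_; _,_; proj₁; proj₂)
open import Data.Sum using (_⊎_; inj₁; inj₂; [_,_]′)
open import Data.Vec using (Vec; []; _∷_; lookup; tabulate)
import Data.Vec as Vec
open import Data.Vec.Properties using (lookup∘tabulate; tabulate∘lookup; tabulate-cong)
open import Data.Unit using (⊤)
open import Function using (_∘_; id)
open import Function.Bundles using (Equivalence)
open import Relation.Binary.PropositionalEquality using (_≡_; _≢_; refl; sym; trans; cong; cong₂; subst)
open import Relation.Nullary using (¬_; Dec; yes; no; does; contradiction)
open import Relation.Nullary.Decidable using (dec-true; dec-false; _×-dec_; _⊎-dec_)

private
  variable
    n k l : ℕ

-- Booleans, vectors and duplicate-free lists

does-true : ∀ {P : Set} (P? : Dec P) → does P? ≡ true → P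
does-true (yes p) _ = p

∨-true⁻ : ∀ {a b} → a ∨ b ≡ true → a ≡ true ⊎ b ≡ true
∨-true⁻ {true}  _ = inj₁ refl
∨-true⁻ {false} p = inj₂ p

∨-trueˡ : ∀ {a b} → a ≡ true → a ∨ b ≡ true
∨-trueˡ refl = refl

∨-trueʳ : ∀ {a b} → b ≡ true → a ∨ b ≡ true
∨-trueʳ {a} refl = ∨-zeroʳ a

∧-true⁻ : ∀ {a b} → a ∧ b ≡ true → a ≡ true × b ≡ true
∧-true⁻ {true} {true} _ = refl , refl

∧-true : ∀ {a b} → a ≡ true → b ≡ true → a ∧ b ≡ true
∧-true refl refl = refl

⇔⇒≡ : ∀ {a b} → (a ≡ true → b ≡ true) → (b ≡ true → a ≡ true) → a ≡ b
⇔⇒≡ {true}          f g = sym (f refl)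
⇔⇒≡ {false} {true}  f g = g refl
⇔⇒≡ {false} {false} f g = refl

lookup-ext : ∀ {A : Set} {xs ys : Vec A n} → (∀ i → lookup xs i ≡ lookup ys i) → xs ≡ ys
lookup-ext {xs = xs} {ys} eq =
  trans (sym (tabulate∘lookup xs)) (trans (tabulate-cong eq) (tabulate∘lookup ys))

lookup-matrix : ∀ (f : Fin n → Fin n → Bool) u v → (tabulate λ a → tabulate (f a)) [ u , v ] ≡ f u v
lookup-matrix f u v =
  trans (cong (λ r → lookup r v) (lookup∘tabulate (λ a → tabulate (f a)) u)) (lookup∘tabulate (f u) v)

-- Serves both bounds: a family of distinct subgraphs fits into the full list of a `CoreIndex`, and
-- that list fits into the enumeration for the lollipop. The head of `xs` is cut out of `ys`; by
-- uniqueness the rest of `xs` survives the cut.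
unique-⊆⇒length≤ : ∀ {A : Set} {xs ys : List A} → Unique xs → (∀ {x} → x ∈ xs → x ∈ ys) →
                    length xs ≤ length ys
unique-⊆⇒length≤ {xs = []} _ _ = z≤n
unique-⊆⇒length≤ {xs = x ∷ xs} (x≢ ∷ uniq) xs⊆ys with ∈-∃++ (xs⊆ys (here refl))
... | as , bs , refl = begin
  suc (length xs)           ≤⟨ s≤s (unique-⊆⇒length≤ uniq xs⊆) ⟩
  suc (length (as ++ bs))   ≡⟨ cong suc (length-++ as) ⟩
  suc (length as + length bs) ≡⟨ sym (+-suc (length as) (length bs)) ⟩
  length as + length (x ∷ bs) ≡⟨ sym (length-++ as) ⟩
  length (as ++ x ∷ bs)     ∎
  where
  open ≤-Reasoning
  xs⊆ : ∀ {z} → z ∈ xs → z ∈ as ++ bs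
  xs⊆ z∈ with ∈-++⁻ as (xs⊆ys (there z∈))
  ... | inj₁ z∈as          = ∈-++⁺ˡ z∈as
  ... | inj₂ (here refl)   = contradiction refl (All.lookup x≢ z∈)
  ... | inj₂ (there z∈bs)  = ∈-++⁺ʳ as z∈bs

unique-map : ∀ {A B : Set} (f : A → B) {xs} →
             (∀ {x y} → x ∈ xs → y ∈ xs → f x ≡ f y → x ≡ y) → Unique xs → Unique (map f xs)
unique-map f inj [] = []
unique-map f inj (x≢ ∷ uniq) =
  All.map⁺ (All.tabulate λ y∈ eq → All.lookup x≢ y∈ (inj (here refl) (there y∈) eq))
  ∷ unique-map f (λ x∈ y∈ → inj (there x∈) (there y∈)) uniq

∉⇒unique : ∀ {A : Set} {x : A} {xs} → x ∉ xs → Unique xs → Unique (x ∷ xs)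
∉⇒unique x∉ uniq = All.tabulate (λ y∈ eq → x∉ (subst (_∈ _) (sym eq) y∈)) ∷ uniq

unique-Fin⇒length≤ : {S : List (Fin n)} → Unique S → length S ≤ n
unique-Fin⇒length≤ {n = n} uniq =
  ≤-trans (unique-⊆⇒length≤ uniq (λ _ → ∈-allFin _)) (≤-reflexive (length-tabulate id))

complete-Fin⇒length≥ : {S : List (Fin n)} → (∀ u → u ∈ S) → n ≤ length S
complete-Fin⇒length≥ {n = n} all =
  ≤-trans (≤-reflexive (sym (length-tabulate id))) (unique-⊆⇒length≤ (allFin⁺ n) (λ {u} _ → all u))

-- Walks and the growth of vertex sets

Symmetric : Adj n → Set
Symmetric A = ∀ u v → A [ u , v ] ≡ A [ v , u ]

walk-map : ∀ {A B : Adj n} → (∀ u v → A [ u , v ] ≡ true → B [ u , v ] ≡ true) →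
           ∀ {u v} → Walk A u v → Walk B u v
walk-map f here       = here
walk-map f (step e w) = step (f _ _ e) (walk-map f w)

walk-++ : ∀ {A : Adj n} {u v w} → Walk A u v → Walk A v w → Walk A u w
walk-++ here       q = q
walk-++ (step e p) q = step e (walk-++ p q)

walk-reverse : ∀ {A : Adj n} → Symmetric A → ∀ {u v} → Walk A u v → Walk A v u
walk-reverse A-sym here       = here
walk-reverse A-sym (step e p) = walk-++ (walk-reverse A-sym p) (step (trans (A-sym _ _) e) here)

module _ {n : ℕ} where
  open DecMembership (_≟_ {n}) using (_∈?_) public

crossing-edge : ∀ {A : Adj n} {S : List (Fin n)} {u v} → Walk A u v → u ∈ S → v ∉ S →
                ∃₂ λ a b → a ∈ S × b ∉ S × A [ a , b ] ≡ true
crossing-edge here u∈ v∉ = contradiction u∈ v∉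
crossing-edge {S = S} (step {w = w} e p) u∈ v∉ with w ∈? S
... | yes w∈ = crossing-edge p w∈ v∉
... | no  w∉ = _ , _ , u∈ , w∉ , e

-- While `S` misses a vertex, connectedness yields an edge leaving `S`, and its outer end is added.
-- Both inductions of the lower bound run through this.
grow : {A : Adj n} (P : List (Fin n) → Set) → Connected A →
       (∀ {S u v} → u ∈ S → v ∉ S → A [ u , v ] ≡ true → P S → P (v ∷ S)) →
       ∀ {S r} → r ∈ S → Unique S → P S → ∃ λ T → (∀ u → u ∈ T) × P T
grow {n = n} {A = A} P conn extend {S₀} = go n (m≤n+m n (length S₀))
  where
  go : ∀ fuel {S r} → n ≤ length S + fuel → r ∈ S → Unique S → P S → ∃ λ T → (∀ u → u ∈ T) × P T
  go fuel {S} {r} bound r∈ uniq p with all? (_∈? S)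
  ... | yes all = S , all , p
  ... | no ¬all with ¬∀⟶∃¬ n (_∈ S) (_∈? S) ¬all
  ... | w , w∉ with crossing-edge (conn r w) r∈ w∉
  -- Without fuel `S` already has `n` distinct entries, so `b` would be one too many.
  go zero {S} bound r∈ uniq p | no _ | _ | a , b , a∈ , b∉ , e =
    ⊥-elim (<-irrefl refl (≤-trans (s≤s (subst (n ≤_) (+-identityʳ _) bound))
      (unique-Fin⇒length≤ (∉⇒unique b∉ uniq))))
  go (suc fuel) {S} bound r∈ uniq p | no _ | _ | a , b , a∈ , b∉ , e =
    go fuel (subst (n ≤_) (+-suc _ fuel) bound) (there r∈) (∉⇒unique b∉ uniq) (extend a∈ b∉ e p)

-- Connected subgraphs

-- Records rather than the bare equations, so that unification can recover the indices.
record _∈ᵥ_ (u : Fin n) (s : Sub n) : Set where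
  constructor vertex
  field isVertex : lookup (proj₁ s) u ≡ true

open _∈ᵥ_

record HasEdge (s : Sub n) (u v : Fin n) : Set where
  constructor edge
  field isEdge : proj₂ s [ u , v ] ≡ true

open HasEdge

record ConnSub (A : Adj n) (s : Sub n) : Set where
  field
    edge-sym    : ∀ {u v} → HasEdge s u v → HasEdge s v u
    edge-⊆      : ∀ {u v} → HasEdge s u v → A [ u , v ] ≡ true
    edge-source : ∀ {u v} → HasEdge s u v → u ∈ᵥ s
    nonempty    : ∃ λ u → u ∈ᵥ s
    walks       : ∀ {u v} → u ∈ᵥ s → v ∈ᵥ s → Walk (proj₂ s) u v

  edge-target : ∀ {u v} → HasEdge s u v → v ∈ᵥ s
  edge-target = edge-source ∘ edge-sym

open ConnSub

toConnSub : ∀ {A : Adj n} {s} → IsConnSub A s → ConnSub A s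
toConnSub (E-sym , E⊆A , ends , (r , r∈) , walk) = record
  { edge-sym    = λ {u} {v} (edge e) → edge (trans (E-sym v u) e)
  ; edge-⊆      = λ (edge e) → E⊆A _ _ e
  ; edge-source = λ (edge e) → vertex (proj₁ (ends _ _ e))
  ; nonempty    = r , vertex r∈
  ; walks       = λ (vertex u∈) (vertex v∈) → walk _ _ u∈ v∈
  }

fromConnSub : ∀ {A : Adj n} {s} → ConnSub A s → IsConnSub A s
fromConnSub c =
    (λ u v → ⇔⇒≡ (isEdge ∘ c .edge-sym ∘ edge) (isEdge ∘ c .edge-sym ∘ edge))
  , (λ u v e → c .edge-⊆ (edge e))
  , (λ u v e → isVertex (c .edge-source (edge e)) , isVertex (edge-target c (edge e)))
  , (proj₁ (c .nonempty) , isVertex (proj₂ (c .nonempty)))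
  , λ u v u∈ v∈ → c .walks (vertex u∈) (vertex v∈)

sub-ext : {s t : Sub n} →
          (∀ {u} → u ∈ᵥ s → u ∈ᵥ t) → (∀ {u} → u ∈ᵥ t → u ∈ᵥ s) →
          (∀ {u v} → HasEdge s u v → HasEdge t u v) → (∀ {u v} → HasEdge t u v → HasEdge s u v) → s ≡ t
sub-ext V⊆ V⊇ E⊆ E⊇ = cong₂ _,_
  (lookup-ext λ u → ⇔⇒≡ (isVertex ∘ V⊆ ∘ vertex) (isVertex ∘ V⊇ ∘ vertex))
  (lookup-ext λ u → lookup-ext λ v → ⇔⇒≡ (isEdge ∘ E⊆ ∘ edge) (isEdge ∘ E⊇ ∘ edge))

-- Single vertices and the attachment of an edge

Joins : Fin n → Fin n → Fin n → Fin n → Set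
Joins u w a b = (a ≡ u × b ≡ w) ⊎ (a ≡ w × b ≡ u)

joins? : (u w a b : Fin n) → Dec (Joins u w a b)
joins? u w a b = ((a ≟ u) ×-dec (b ≟ w)) ⊎-dec ((a ≟ w) ×-dec (b ≟ u))

joins-sym : ∀ {u w a b : Fin n} → Joins u w a b → Joins u w b a
joins-sym (inj₁ (p , q)) = inj₂ (q , p)
joins-sym (inj₂ (p , q)) = inj₁ (q , p)

single : Fin n → Sub n
single u = tabulate (λ a → does (a ≟ u)) , tabulate λ _ → tabulate λ _ → false

∈-single⁻ : ∀ {u a : Fin n} → a ∈ᵥ single u → a ≡ u
∈-single⁻ {u = u} {a} (vertex p) = does-true (a ≟ u) (trans (sym (lookup∘tabulate _ a)) p)

∈-single : (u : Fin n) → u ∈ᵥ single u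
∈-single u = vertex (trans (lookup∘tabulate _ u) (dec-true (u ≟ u) refl))

single-noEdge : ∀ {u a b : Fin n} → ¬ HasEdge (single u) a b
single-noEdge {a = a} {b} (edge p) with trans (sym (lookup-matrix (λ _ _ → false) a b)) p
... | ()

single-connected : ∀ {A : Adj n} u → ConnSub A (single u)
single-connected u = record
  { edge-sym    = ⊥-elim ∘ single-noEdge
  ; edge-⊆      = ⊥-elim ∘ single-noEdge
  ; edge-source = ⊥-elim ∘ single-noEdge
  ; nonempty    = u , ∈-single u
  ; walks       = λ a∈ b∈ → subst (Walk _ _) (trans (∈-single⁻ a∈) (sym (∈-single⁻ b∈))) here
  }

opaque
  -- One operation for two purposes: with `w` outside the subgraph it hangs on a new vertex, with
  -- `w` inside it adds an edge.
  attach : Fin n → Fin n → Sub n → Sub n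
  attach u w (V , E) =
      tabulate (λ a → does (a ≟ w) ∨ lookup V a)
    , tabulate λ a → tabulate λ b → does (joins? u w a b) ∨ E [ a , b ]

module _ {u w : Fin n} {s : Sub n} where

  opaque
    unfolding attach

    ∈-attach⁻ : ∀ {a} → a ∈ᵥ attach u w s → a ≡ w ⊎ a ∈ᵥ s
    ∈-attach⁻ {a} (vertex p) with ∨-true⁻ (trans (sym (lookup∘tabulate _ a)) p)
    ... | inj₁ q = inj₁ (does-true (a ≟ w) q)
    ... | inj₂ q = inj₂ (vertex q)

    ∈-attach-new : w ∈ᵥ attach u w s
    ∈-attach-new = vertex (trans (lookup∘tabulate _ w) (∨-trueˡ (dec-true (w ≟ w) refl)))

    ∈-attach-old : ∀ {a} → a ∈ᵥ s → a ∈ᵥ attach u w s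
    ∈-attach-old {a} (vertex p) = vertex (trans (lookup∘tabulate _ a) (∨-trueʳ p))

    edge-attach⁻ : ∀ {a b} → HasEdge (attach u w s) a b → Joins u w a b ⊎ HasEdge s a b
    edge-attach⁻ {a} {b} (edge p) with ∨-true⁻ (trans (sym (lookup-matrix _ a b)) p)
    ... | inj₁ q = inj₁ (does-true (joins? u w a b) q)
    ... | inj₂ q = inj₂ (edge q)

    edge-attach-new : ∀ {a b} → Joins u w a b → HasEdge (attach u w s) a b
    edge-attach-new {a} {b} j = edge (trans (lookup-matrix _ a b) (∨-trueˡ (dec-true (joins? u w a b) j)))

    edge-attach-old : ∀ {a b} → HasEdge s a b → HasEdge (attach u w s) a b
    edge-attach-old {a} {b} (edge p) = edge (trans (lookup-matrix _ a b) (∨-trueʳ p))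

-- Every vertex reaches `u`, within `s` or across the new edge, so walks can be composed at `u`.
attach-connected : ∀ {A : Adj n} {u w s} → Symmetric A → A [ u , w ] ≡ true → u ∈ᵥ s →
                   ConnSub A s → ConnSub A (attach u w s)
attach-connected {A = A} {u} {w} {s} A-sym uw u∈ c = record
  { edge-sym    = s′-sym
  ; edge-⊆      = s′-⊆
  ; edge-source = s′-source
  ; nonempty    = u , ∈-attach-old u∈
  ; walks       = λ a∈ b∈ → walk-++ (to-u a∈)
      (walk-reverse (λ a b → ⇔⇒≡ (isEdge ∘ s′-sym ∘ edge) (isEdge ∘ s′-sym ∘ edge)) (to-u b∈))
  }
  where
  s′ = attach u w s
  s′-sym : ∀ {a b} → HasEdge s′ a b → HasEdge s′ b a
  s′-sym e = [ edge-attach-new ∘ joins-sym , edge-attach-old ∘ c .edge-sym ]′ (edge-attach⁻ e)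
  s′-⊆ : ∀ {a b} → HasEdge s′ a b → A [ a , b ] ≡ true
  s′-⊆ e with edge-attach⁻ e
  ... | inj₁ (inj₁ (refl , refl)) = uw
  ... | inj₁ (inj₂ (refl , refl)) = trans (A-sym w u) uw
  ... | inj₂ p                    = c .edge-⊆ p
  s′-source : ∀ {a b} → HasEdge s′ a b → a ∈ᵥ s′
  s′-source e with edge-attach⁻ e
  ... | inj₁ (inj₁ (refl , refl)) = ∈-attach-old u∈
  ... | inj₁ (inj₂ (refl , refl)) = ∈-attach-new
  ... | inj₂ p                    = ∈-attach-old (c .edge-source p)
  to-u : ∀ {a} → a ∈ᵥ s′ → Walk (proj₂ s′) a u
  to-u a∈ with ∈-attach⁻ a∈
  ... | inj₁ refl = step (isEdge (edge-attach-new {s = s} (inj₂ (refl , refl)))) here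
  ... | inj₂ a∈s  = walk-map (λ _ _ e → isEdge (edge-attach-old {s = s} (edge e))) (c .walks a∈s u∈)

-- Lower bounds on the number of connected subgraphs

-- A lower bound by explicit witnesses. `size` is an inequality, so that a smaller bound needs no
-- shorter list.
record Family (A : Adj n) (Q : Sub n → Set) (k : ℕ) : Set where
  constructor family
  field
    members : List (Sub n)
    unique  : Unique members
    member  : ∀ {s} → s ∈ members → ConnSub A s × Q s
    size    : k ≤ length members

open Family

module _ {A : Adj n} where

  weaken : ∀ {Q Q′ : Sub n → Set} → (∀ {s} → ConnSub A s → Q s → Q′ s) →
           Family A Q k → Family A Q′ k
  weaken f F .members   = F .members
  weaken f F .unique    = F .unique
  weaken f F .member s∈ = proj₁ (F .member s∈) , f (proj₁ (F .member s∈)) (proj₂ (F .member s∈))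
  weaken f F .size      = F .size

  shrink : ∀ {Q : Sub n → Set} → l ≤ k → Family A Q k → Family A Q l
  shrink l≤k F = record { Family F hiding (size) ; size = ≤-trans l≤k (F .size) }

  singleton : ∀ {Q : Sub n → Set} s → ConnSub A s → Q s → Family A Q 1
  singleton s c q = family (s ∷ []) ([] ∷ []) (λ { (here refl) → c , q }) ≤-refl

  merge : ∀ {Q Q′ : Sub n → Set} → (∀ {s} → ConnSub A s → Q s → ¬ Q′ s) →
          Family A Q k → Family A Q′ l → Family A (λ s → Q s ⊎ Q′ s) (k + l)
  merge disjoint F F′ .members = F .members ++ F′ .members
  merge disjoint F F′ .unique  = unique-++ (F .unique) (F′ .unique) λ (s∈ , s∈′) →
    disjoint (proj₁ (F .member s∈)) (proj₂ (F .member s∈)) (proj₂ (F′ .member s∈′))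
  merge disjoint F F′ .member s∈ with ∈-++⁻ (F .members) s∈
  ... | inj₁ p = proj₁ (F .member p) , inj₁ (proj₂ (F .member p))
  ... | inj₂ p = proj₁ (F′ .member p) , inj₂ (proj₂ (F′ .member p))
  merge disjoint F F′ .size = ≤-trans (+-mono-≤ (F .size) (F′ .size)) (≤-reflexive (sym (length-++ (F .members))))

  image : ∀ {Q Q′ : Sub n → Set} (f : Sub n → Sub n) →
          (∀ {s} → ConnSub A s → Q s → ConnSub A (f s) × Q′ (f s)) →
          (∀ {s t} → ConnSub A s → Q s → ConnSub A t → Q t → f s ≡ f t → s ≡ t) →
          Family A Q k → Family A Q′ k
  image f pres inj F .members = map f (F .members)
  image f pres inj F .unique  = unique-map f
    (λ s∈ t∈ → inj (proj₁ (F .member s∈)) (proj₂ (F .member s∈)) (proj₁ (F .member t∈)) (proj₂ (F .member t∈)))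
    (F .unique)
  image f pres inj F .member s∈ with ∈-map⁻ f s∈
  ... | t , t∈ , refl = pres (proj₁ (F .member t∈)) (proj₂ (F .member t∈))
  image f pres inj F .size = ≤-trans (F .size) (≤-reflexive (sym (length-map f (F .members))))

  module _ {u w : Fin n} where

    -- An edge of `s` persists in `attach u w t`; not being `uw`, it comes from `t`.
    attach-reflects-edges : ∀ {s t} → ConnSub A s → ¬ HasEdge s u w → attach u w s ≡ attach u w t →
                            ∀ {a b} → HasEdge s a b → HasEdge t a b
    attach-reflects-edges c uw∉ eq e
      with edge-attach⁻ (subst (λ r → HasEdge r _ _) eq (edge-attach-old e))
    ... | inj₁ (inj₁ (refl , refl)) = contradiction e uw∉
    ... | inj₁ (inj₂ (refl , refl)) = contradiction (c .edge-sym e) uw∉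
    ... | inj₂ p                    = p

    attach-reflects-vertices : ∀ {s t} → ¬ w ∈ᵥ s → attach u w s ≡ attach u w t →
                               ∀ {a} → a ∈ᵥ s → a ∈ᵥ t
    attach-reflects-vertices w∉ eq a∈ with ∈-attach⁻ (subst (_ ∈ᵥ_) eq (∈-attach-old a∈))
    ... | inj₁ refl = contradiction a∈ w∉
    ... | inj₂ p    = p

    attachVertex : ∀ {Q Q′ : Sub n → Set} → Symmetric A → A [ u , w ] ≡ true →
                   (∀ {s} → Q s → u ∈ᵥ s × ¬ w ∈ᵥ s) → (∀ {s} → Q s → Q′ (attach u w s)) →
                   Family A Q k → Family A Q′ k
    attachVertex A-sym uw fresh pres = image (attach u w)
      (λ c q → attach-connected A-sym uw (proj₁ (fresh q)) c , pres q)
      λ cs qs ct qt eq → sub-ext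
        (attach-reflects-vertices (proj₂ (fresh qs)) eq)
        (attach-reflects-vertices (proj₂ (fresh qt)) (sym eq))
        (attach-reflects-edges cs (proj₂ (fresh qs) ∘ edge-target cs) eq)
        (attach-reflects-edges ct (proj₂ (fresh qt) ∘ edge-target ct) (sym eq))

  -- A connected subgraph with an edge has no isolated vertex: the walk from `a` to `x` begins with
  -- an edge at `a`, unless `a` is `x` itself.
  edges-determine-vertices : ∀ {s t x y} → ConnSub A s → ConnSub A t → HasEdge s x y →
                             (∀ {a b} → HasEdge s a b → HasEdge t a b) → ∀ {a} → a ∈ᵥ s → a ∈ᵥ t
  edges-determine-vertices cs ct xy E⊆ a∈ with cs .walks a∈ (cs .edge-source xy)
  ... | here     = ct .edge-source (E⊆ xy)
  ... | step e _ = ct .edge-source (E⊆ (edge e))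

  -- Here `w` may lie in some members and not in others, so the result does not show whether `w` is
  -- new. Injectivity rests on the edges alone, and the common edge `xy` makes them determine the
  -- vertices.
  attachEdge : ∀ {Q Q′ : Sub n → Set} {u w x y} → Symmetric A → A [ u , w ] ≡ true →
               (∀ {s} → Q s → u ∈ᵥ s × ¬ HasEdge s u w × HasEdge s x y) → (∀ {s} → Q s → Q′ (attach u w s)) →
               Family A Q k → Family A Q′ k
  attachEdge {u = u} {w} A-sym uw fresh pres = image (attach u w)
    (λ c q → attach-connected A-sym uw (proj₁ (fresh q)) c , pres q)
    λ cs qs ct qt eq →
      let E⊆ = λ {a b} → attach-reflects-edges cs (proj₁ (proj₂ (fresh qs))) eq {a} {b}
          E⊇ = λ {a b} → attach-reflects-edges ct (proj₁ (proj₂ (fresh qt))) (sym eq) {a} {b}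
      in sub-ext
        (edges-determine-vertices cs ct (proj₂ (proj₂ (fresh qs))) E⊆)
        (edges-determine-vertices ct cs (proj₂ (proj₂ (fresh qt))) E⊇)
        E⊆ E⊇

-- The triangular bound for connected graphs

Within : List (Fin n) → Sub n → Set
Within S s = ∀ u → u ∈ᵥ s → u ∈ S

within-there : ∀ {S : List (Fin n)} {v s} → Within S s → Within (v ∷ S) s
within-there W u u∈ = there (W u u∈)

within-single : ∀ {S : List (Fin n)} {u} → u ∈ S → Within S (single u)
within-single u∈ a a∈ = subst (_∈ _) (sym (∈-single⁻ a∈)) u∈

within-attach : ∀ {S : List (Fin n)} {u w s} → w ∈ S → Within S s → Within S (attach u w s)
within-attach w∈ W a a∈ with ∈-attach⁻ a∈
... | inj₁ refl = w∈
... | inj₂ a∈s  = W a a∈s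

triangular : ℕ → ℕ
triangular zero    = 0
triangular (suc k) = suc k + triangular k

-- The invariant passed to `grow`. `rooted` feeds the step for `total`, and the connected subgraph
-- covering `S` feeds the step for `rooted`.
record Rooted (A : Adj n) (S : List (Fin n)) : Set where
  field
    total    : Family A (Within S) (triangular (length S))
    rooted   : ∀ {u} → u ∈ S → Family A (λ s → Within S s × u ∈ᵥ s) (length S)
    spanning : Sub n
    connects : ConnSub A spanning
    within   : Within S spanning
    covers   : ∀ {u} → u ∈ S → u ∈ᵥ spanning

open Rooted

rooted-single : ∀ {A : Adj n} r → Rooted A (r ∷ [])
rooted-single r .total    = singleton (single r) (single-connected r) (within-single (here refl))
rooted-single r .rooted (here refl) =
  singleton (single r) (single-connected r) (within-single (here refl) , ∈-single r)
rooted-single r .spanning = single r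
rooted-single r .connects = single-connected r
rooted-single r .within   = within-single (here refl)
rooted-single r .covers (here refl) = ∈-single r

-- Through `v` there are `v` alone and the subgraphs through `u` with `v` attached. Through an old
-- vertex there are the old subgraphs and the spanning one enlarged by `v`.
rooted-extend : ∀ {A : Adj n} → Symmetric A → ∀ {S u v} → u ∈ S → v ∉ S → A [ u , v ] ≡ true →
                Rooted A S → Rooted A (v ∷ S)
rooted-extend {A = A} A-sym {S} {u} {v} u∈ v∉ uv T = T′
  where
  v≢u : v ≢ u
  v≢u refl = v∉ u∈
  at-v : Family A (λ s → Within (v ∷ S) s × v ∈ᵥ s) (suc (length S))
  at-v = weaken (λ _ → [ (λ (W , v∈ , _) → W , v∈) , (λ (W , v∈ , _) → W , v∈) ]′)
    (merge {Q = λ s → Within (v ∷ S) s × v ∈ᵥ s × ¬ u ∈ᵥ s} {λ s → Within (v ∷ S) s × v ∈ᵥ s × u ∈ᵥ s}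
      (λ _ (_ , _ , u∉) (_ , _ , u∈s) → u∉ u∈s)
      (singleton (single v) (single-connected v)
        (within-single (here refl) , ∈-single v , λ u∈s → v≢u (sym (∈-single⁻ u∈s))))
      (attachVertex A-sym uv (λ (W , u∈s) → u∈s , λ v∈s → v∉ (W v v∈s))
        (λ (W , u∈s) → within-attach (here refl) (within-there W) , ∈-attach-new , ∈-attach-old u∈s)
        (T .rooted u∈)))
  whole : Sub _
  whole = attach u v (T .spanning)
  whole-connected : ConnSub A whole
  whole-connected = attach-connected A-sym uv (T .covers u∈) (T .connects)
  whole-within : Within (v ∷ S) whole
  whole-within = within-attach (here refl) (within-there (T .within))
  T′ : Rooted A (v ∷ S)
  T′ .total = weaken (λ _ → [ proj₁ , within-there ]′)
    (merge (λ _ (_ , v∈s) W → v∉ (W v v∈s)) at-v (T .total))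
  T′ .rooted (here refl) = at-v
  T′ .rooted {w} (there w∈) = weaken (λ _ → [ (λ (W , w∈s , _) → W , w∈s) , (λ (W , w∈s) → within-there W , w∈s) ]′)
    (merge {Q = λ s → Within (v ∷ S) s × w ∈ᵥ s × v ∈ᵥ s}
      (λ _ (_ , _ , v∈s) (W , _) → v∉ (W v v∈s))
      (singleton whole whole-connected (whole-within , ∈-attach-old (T .covers w∈) , ∈-attach-new))
      (T .rooted w∈))
  T′ .spanning = whole
  T′ .connects = whole-connected
  T′ .within   = whole-within
  T′ .covers (here refl) = ∈-attach-new
  T′ .covers (there w∈)  = ∈-attach-old (T .covers w∈)

triangular-mono : k ≤ l → triangular k ≤ triangular l
triangular-mono z≤n         = z≤n
triangular-mono (s≤s k≤l) = +-mono-≤ (s≤s k≤l) (triangular-mono k≤l)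

-- Deleting an edge

_∖[_,_] : Adj n → Fin n → Fin n → Adj n
A ∖[ x , y ] = tabulate λ a → tabulate λ b → A [ a , b ] ∧ not (does (joins? x y a b))

module _ {A : Adj n} {x y : Fin n} where

  edge-∖⁻ : ∀ a b → (A ∖[ x , y ]) [ a , b ] ≡ true → A [ a , b ] ≡ true × ¬ Joins x y a b
  edge-∖⁻ a b e with ∧-true⁻ (trans (sym (lookup-matrix _ a b)) e)
  ... | p , q = p , λ j → contradiction (trans (sym q) (cong not (dec-true (joins? x y a b) j))) λ ()

  edge-∖ : ∀ {a b} → A [ a , b ] ≡ true → ¬ Joins x y a b → (A ∖[ x , y ]) [ a , b ] ≡ true
  edge-∖ {a} {b} p ¬j = trans (lookup-matrix _ a b) (∧-true p (cong not (dec-false (joins? x y a b) ¬j)))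

  ∖-symmetric : Symmetric A → Symmetric (A ∖[ x , y ])
  ∖-symmetric A-sym a b = ⇔⇒≡ (half a b) (half b a)
    where
    half : ∀ a b → (A ∖[ x , y ]) [ a , b ] ≡ true → (A ∖[ x , y ]) [ b , a ] ≡ true
    half a b e = edge-∖ (trans (A-sym b a) (proj₁ (edge-∖⁻ a b e))) (proj₂ (edge-∖⁻ a b e) ∘ joins-sym)

  connSub-∖ : ∀ {s} → ConnSub (A ∖[ x , y ]) s → ConnSub A s × ¬ HasEdge s x y
  connSub-∖ c =
    record { ConnSub c using (edge-sym; edge-source; nonempty; walks) ; edge-⊆ = λ e → proj₁ (edge-∖⁻ _ _ (c .edge-⊆ e)) } ,
    λ e → proj₂ (edge-∖⁻ x y (c .edge-⊆ e)) (inj₁ (refl , refl))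

  -- Each passage of a walk through `xy` is replaced by the detour or its reverse.
  ∖-connected : Symmetric A → Connected A → Walk (A ∖[ x , y ]) y x → Connected (A ∖[ x , y ])
  ∖-connected A-sym conn detour u v = reroute (conn u v)
    where
    reroute : ∀ {u v} → Walk A u v → Walk (A ∖[ x , y ]) u v
    reroute here = here
    reroute (step {u} {w} e p) with joins? x y u w
    ... | yes (inj₁ (refl , refl)) = walk-++ (walk-reverse (∖-symmetric A-sym) detour) (reroute p)
    ... | yes (inj₂ (refl , refl)) = walk-++ detour (reroute p)
    ... | no ¬j = step (edge-∖ e ¬j) (reroute p)

connected⇒triangular : ∀ {A : Adj n} → Fin n → Symmetric A → Connected A →
                       Family A (λ _ → ⊤) (triangular n)
connected⇒triangular r A-sym conn
  with grow (Rooted _) conn (rooted-extend A-sym) (here refl) ([] ∷ []) (rooted-single r)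
... | S , all , T = shrink (triangular-mono (complete-Fin⇒length≥ all)) (weaken _ (T .total))

-- Paths without repeated vertices

data Path (A : Adj n) : Fin n → Fin n → List (Fin n) → Set where
  stop : ∀ {u} → Path A u u (u ∷ [])
  cons : ∀ {u w v L} → A [ u , w ] ≡ true → u ∉ L → Path A w v L → Path A u v (u ∷ L)

module _ {A : Adj n} where

  path-first : ∀ {u v L} → Path A u v L → u ∈ L
  path-first stop         = here refl
  path-first (cons _ _ _) = here refl

  path-last : ∀ {u v L} → Path A u v L → v ∈ L
  path-last stop         = here refl
  path-last (cons _ _ p) = there (path-last p)

  path-unique : ∀ {u v L} → Path A u v L → Unique L
  path-unique stop          = [] ∷ []
  path-unique (cons _ u∉ p) = ∉⇒unique u∉ (path-unique p)

  path⇒walk : ∀ {B : Adj n} {u v L} →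
              (∀ {a b} → a ∈ L → b ∈ L → A [ a , b ] ≡ true → B [ a , b ] ≡ true) →
              Path A u v L → Walk B u v
  path⇒walk f stop         = here
  path⇒walk f (cons e _ p) = step (f (here refl) (there (path-first p)) e)
    (path⇒walk (λ a∈ b∈ → f (there a∈) (there b∈)) p)

  -- The cut for a path that closes up at `w`: `left` stops one vertex before `w` and becomes part
  -- of the cycle, `right` leads away from the cycle.
  record Split (u w v : Fin n) (L : List (Fin n)) : Set where
    field
      {end}       : Fin n
      {init tail} : List (Fin n)
      left        : Path A u end init
      link        : A [ end , w ] ≡ true
      right       : Path A w v tail
      disjoint    : ∀ {a} → a ∈ init → a ∉ tail
      init⊆       : ∀ {a} → a ∈ init → a ∈ L
      tail⊆       : ∀ {a} → a ∈ tail → a ∈ L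

  split : ∀ {u w v L} → Path A u v L → w ∈ L → w ≢ u → Split u w v L
  split stop (here refl) w≢u = contradiction refl w≢u
  split (cons e u∉ p) (here refl) w≢u = contradiction refl w≢u
  split {w = w} (cons {w = u′} e u∉ p) (there w∈) w≢u with w ≟ u′
  ... | yes refl = record
    { left = stop ; link = e ; right = p ; disjoint = λ { (here refl) → u∉ }
    ; init⊆ = λ { (here refl) → here refl } ; tail⊆ = there }
  ... | no w≢u′ = record
    { left = cons e (u∉ ∘ Split.init⊆ r) (Split.left r) ; link = Split.link r ; right = Split.right r
    ; disjoint = λ { (here refl) → u∉ ∘ Split.tail⊆ r ; (there a∈) → Split.disjoint r a∈ }
    ; init⊆ = λ { (here refl) → here refl ; (there a∈) → there (Split.init⊆ r a∈) }
    ; tail⊆ = there ∘ Split.tail⊆ r }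
    where r = split p w∈ w≢u′

-- Degrees and the search for a cycle

Row : ℕ → Set
Row = Vec Bool

weight : Row n → ℕ
weight r = Vec.sum (Vec.map b2n r)

weight-0⇒false : (r : Row n) → weight r ≡ 0 → ∀ a → lookup r a ≢ true
weight-0⇒false (false ∷ r) eq (suc a) p = weight-0⇒false r eq a p

weight-≢0⇒∃ : (r : Row n) → weight r ≢ 0 → ∃ λ a → lookup r a ≡ true
weight-≢0⇒∃ []          ≢0 = contradiction refl ≢0
weight-≢0⇒∃ (true ∷ r)  ≢0 = zero , refl
weight-≢0⇒∃ (false ∷ r) ≢0 with weight-≢0⇒∃ r ≢0
... | a , p = suc a , p

weight-1⇒unique : (r : Row n) → weight r ≡ 1 → ∀ a b → lookup r a ≡ true → lookup r b ≡ true → a ≡ b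
weight-1⇒unique (true ∷ r)  eq zero    zero    p q = refl
weight-1⇒unique (true ∷ r)  eq zero    (suc b) p q = contradiction q (weight-0⇒false r (suc-injective eq) b)
weight-1⇒unique (true ∷ r)  eq (suc a) b       p q = contradiction p (weight-0⇒false r (suc-injective eq) a)
weight-1⇒unique (false ∷ r) eq (suc a) (suc b) p q = cong suc (weight-1⇒unique r eq a b p q)

weight-≢1⇒another : (r : Row n) → weight r ≢ 1 → ∀ a → lookup r a ≡ true → ∃ λ b → b ≢ a × lookup r b ≡ true
weight-≢1⇒another (true ∷ r) ≢1 zero p with weight-≢0⇒∃ r (≢1 ∘ cong suc)
... | b , q = suc b , (λ ()) , q
weight-≢1⇒another (true ∷ r)  ≢1 (suc a) p = zero , (λ ()) , refl
weight-≢1⇒another (false ∷ r) ≢1 (suc a) p with weight-≢1⇒another r ≢1 a p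
... | b , b≢a , q = suc b , (λ { refl → b≢a refl }) , q

-- A cycle, cut open at x into a path from y to z, with an extra neighbour v of x off the cycle.
record Tadpole (G : Graph n) : Set where
  field
    {x v y z} : Fin n
    {L}       : List (Fin n)
    path      : Path G y z L
    y≢z       : y ≢ z
    xy        : G [ x , y ] ≡ true
    xz        : G [ x , z ] ≡ true
    xv        : G [ x , v ] ≡ true
    x∉L       : x ∉ L
    v∉L       : v ∉ L
    v≢x       : v ≢ x

-- Follow a non-backtracking path away from the pendant vertex until it closes up.  It cannot close
-- up at the pendant vertex, so the vertex at which it does has a predecessor off the cycle.
tadpole : {G : Graph n} → IsSimple G → ExactlyOnePendant G → Tadpole G
tadpole {n = n} {G} (G-sym , loopless) (p , deg-p , pendant⇒p)
  with weight-≢0⇒∃ (lookup G p) (λ eq → contradiction (trans (sym deg-p) eq) λ ())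
... | h₀ , ph₀ = search n (m≤n⇒m≤1+n ≤-refl) (swap ph₀) (λ { (here refl) → irreflexive ph₀ }) stop
  where
  swap : ∀ {a b} → G [ a , b ] ≡ true → G [ b , a ] ≡ true
  swap {a} {b} e = trans (G-sym b a) e
  irreflexive : ∀ {a} → ¬ G [ a , a ] ≡ true
  irreflexive {a} e = contradiction (trans (sym e) (loopless a)) λ ()
  -- The path runs backwards, from `t` to the pendant vertex `p`; `h` is the vertex just reached,
  -- and the fuel bounds the number of vertices off `L`.
  search : ∀ fuel {h t L} → n ≤ length L + fuel → G [ h , t ] ≡ true → h ∉ L → Path G t p L → Tadpole G
  search zero bound ht h∉ P = ⊥-elim (<-irrefl refl
    (≤-trans (s≤s (subst (n ≤_) (+-identityʳ _) bound)) (unique-Fin⇒length≤ (∉⇒unique h∉ (path-unique P)))))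
  -- The only pendant vertex `p` is already on the path, so `h` has a neighbour other than `t`.
  search (suc fuel) {h} {t} {L} bound ht h∉ P
    with weight-≢1⇒another (lookup G h) (λ deg → h∉ (subst (_∈ L) (sym (pendant⇒p h deg)) (path-last P))) t ht
  ... | w , w≢t , hw with w ∈? L
  ... | no w∉ = search fuel (subst (n ≤_) (+-suc _ fuel) bound) (swap hw)
          (λ { (here refl) → irreflexive hw ; (there w∈) → w∉ w∈ }) (cons ht h∉ P)
  ... | yes w∈ = close (split P w∈ w≢t)
    where
    close : Split t w p L → Tadpole G
    -- Here `w` is `p`, whose only neighbour would be both `h` and the path vertex before `p`; but
    -- `h` is off the path.
    close s@record { right = stop } =
      contradiction (Split.init⊆ s (path-last (Split.left s)))
        (subst (_∉ L) (weight-1⇒unique (lookup G p) deg-p _ _ (swap hw) (swap (Split.link s))) h∉)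
    -- The roles: `x` is `w`, `y` is `h`, `z` is the end of `left`, and `v` is the vertex following
    -- `w` on `right`.
    close s@record { right = cons e w∉ P′ } = record
      { path = cons ht (h∉ ∘ Split.init⊆ s) (Split.left s)
      ; y≢z  = λ { refl → h∉ (Split.init⊆ s (path-last (Split.left s))) }
      ; xy   = swap hw
      ; xz   = swap (Split.link s)
      ; xv   = e
      ; x∉L  = λ { (here refl) → h∉ w∈ ; (there q) → Split.disjoint s q (here refl) }
      ; v∉L  = λ { (here refl) → h∉ (Split.tail⊆ s (there (path-first P′)))
                 ; (there q) → Split.disjoint s q (there (path-first P′)) }
      ; v≢x  = λ { refl → w∉ (path-first P′) }
      }

-- Connected subgraphs through a fixed edge of the cycle

NoEdgeIn : List (Fin n) → Sub n → Set
NoEdgeIn L s = ∀ {a b} → a ∈ L → b ∈ L → ¬ HasEdge s a b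

module _ {A : Adj n} (A-sym : Symmetric A) {x y : Fin n} where

  -- The path edges are attached one by one; each stage contains an edge absent from all earlier
  -- ones, so the stages are disjoint.
  sweep : ∀ {a z L} (K : Sub n → Set) → (∀ {s} → K s → HasEdge s x y) →
          (∀ {s b c} → c ∈ L → K s → K (attach b c s)) → Path A a z L →
          Family A (λ s → K s × a ∈ᵥ s × NoEdgeIn L s) k →
          Family A K (length L * k) × Family A (λ s → K s × (∀ {b} → b ∈ L → b ∈ᵥ s)) k
  sweep {k = k} K anchored closed stop F =
      shrink (≤-reflexive (+-identityʳ k)) (weaken (λ _ → proj₁) F)
    , weaken (λ _ (κ , a∈ , _) → κ , λ { (here refl) → a∈ }) F
  sweep {a = a} K anchored closed (cons {w = b} {L = L} ab a∉ P) F =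
      weaken (λ _ → [ proj₁ , proj₁ ]′)
        (merge {Q = λ s → K s × ¬ HasEdge s a b} {K′} (λ _ (_ , ¬ab) (_ , e) → ¬ab e)
          (weaken (λ _ (κ , _ , free) → κ , free (here refl) (there b∈)) F) (proj₁ rec))
    -- Only the last stage is kept here: it contains the whole path, hence all of its vertices.
    , weaken (λ c ((κ , e) , all) → κ , λ { (here refl) → c .edge-source e ; (there q) → all q }) (proj₂ rec)
    where
    b∈ : b ∈ L
    b∈ = path-first P
    K′ : Sub n → Set
    K′ s = K s × HasEdge s a b
    still-free : ∀ {s} → NoEdgeIn (a ∷ L) s → NoEdgeIn L (attach a b s)
    still-free free c∈ d∈ e with edge-attach⁻ e
    ... | inj₁ (inj₁ (refl , refl)) = a∉ c∈
    ... | inj₁ (inj₂ (refl , refl)) = a∉ d∈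
    ... | inj₂ e′ = free (there c∈) (there d∈) e′
    rec = sweep K′ (λ (κ , _) → anchored κ)
      (λ c∈ (κ , e) → closed (there c∈) κ , edge-attach-old e) P
      (attachEdge A-sym ab (λ (κ , a∈ , free) → a∈ , free (here refl) (there b∈) , anchored κ)
        (λ (κ , a∈ , free) → (closed (there b∈) κ , edge-attach-new (inj₁ (refl , refl))) , ∈-attach-new , still-free free)
        F)

-- The invariant grown from the cycle and its extra neighbour. `count` says that `amount` is at
-- least 4 |S| - 8, written without subtraction; `through` supplies the four subgraphs gained with
-- each further vertex.
record Anchored (A : Adj n) (x y : Fin n) (S : List (Fin n)) : Set where
  field
    {amount} : ℕ
    anchors  : Family A (λ s → Within S s × HasEdge s x y) amount
    count    : 4 * length S ≤ amount + 8
    through  : ∀ {u} → u ∈ S → Family A (λ s → (Within S s × HasEdge s x y) × u ∈ᵥ s) 4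

open Anchored

anchored-extend : ∀ {A : Adj n} {x y} → Symmetric A → ∀ {S u v} → u ∈ S → v ∉ S → A [ u , v ] ≡ true →
                  Anchored A x y S → Anchored A x y (v ∷ S)
anchored-extend {A = A} {x} {y} A-sym {S} {u} {v} u∈ v∉ uv T = T′
  where
  at-v : Family A (λ s → (Within (v ∷ S) s × HasEdge s x y) × v ∈ᵥ s) 4
  at-v = attachVertex A-sym uv (λ ((W , _) , u∈s) → u∈s , λ v∈s → v∉ (W v v∈s))
    (λ ((W , e) , _) → (within-attach (here refl) (within-there W) , edge-attach-old e) , ∈-attach-new)
    (T .through u∈)
  T′ : Anchored A x y (v ∷ S)
  T′ .amount = _
  T′ .anchors = weaken (λ _ → [ proj₁ , (λ (W , e) → within-there W , e) ]′)
    (merge (λ _ (_ , v∈s) (W , _) → v∉ (W v v∈s)) at-v (T .anchors))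
  T′ .count = ≤-trans (≤-reflexive (*-suc 4 (length S))) (+-monoʳ-≤ 4 (T .count))
  T′ .through (here refl) = at-v
  T′ .through (there w∈)  = weaken (λ _ ((W , e) , w∈s) → (within-there W , e) , w∈s) (T .through w∈)

module _ {G : Graph n} (G-sym : Symmetric G) (T : Tadpole G) where
  open Tadpole T

  base : List (Fin n)
  base = v ∷ x ∷ L

  base-unique : Unique base
  base-unique = ∉⇒unique (λ { (here eq) → v≢x eq ; (there v∈) → v∉L v∈ }) (∉⇒unique x∉L (path-unique path))

  private
    y∈L : y ∈ L
    y∈L = path-first path
    z∈L : z ∈ L
    z∈L = path-last path

    K : Sub n → Set
    K s = Within base s × HasEdge s x y

    K-closed : ∀ {s b c} → c ∈ L → K s → K (attach b c s)
    K-closed c∈ (W , e) = within-attach (there (there c∈)) W , edge-attach-old e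

    free-attach : ∀ {s c} → NoEdgeIn L s → NoEdgeIn L (attach x c s)
    free-attach free a∈ b∈ e with edge-attach⁻ e
    ... | inj₁ (inj₁ (refl , refl)) = x∉L a∈
    ... | inj₁ (inj₂ (refl , refl)) = x∉L b∈
    ... | inj₂ e′ = free a∈ b∈ e′

    -- The edge `xy` alone and `xy` together with `xz`. The absence of `v` makes room for attaching
    -- `xv` in `pair-v`.
    pair : Family G (λ s → K s × y ∈ᵥ s × NoEdgeIn L s × ¬ v ∈ᵥ s × x ∈ᵥ s) 2
    pair = weaken (λ _ → [ proj₂ , proj₂ ]′)
      (merge {Q = λ s → ¬ HasEdge s x z × Q s} {λ s → HasEdge s x z × Q s}
        (λ _ (¬e , _) (e , _) → ¬e e)
        (singleton xy-sub xy-conn (xy-no-xz , xy-Q))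
        (singleton (attach x z xy-sub) (attach-connected G-sym xz x∈xy xy-conn)
          (edge-attach-new (inj₁ (refl , refl)) ,
           K-closed z∈L (proj₁ xy-Q) , ∈-attach-old (proj₁ (proj₂ xy-Q)) ,
           free-attach (proj₁ (proj₂ (proj₂ xy-Q))) , v∉-attach z∈L v∉xy , ∈-attach-old x∈xy)))
      where
      Q : Sub n → Set
      Q s = K s × y ∈ᵥ s × NoEdgeIn L s × ¬ v ∈ᵥ s × x ∈ᵥ s
      xy-sub : Sub n
      xy-sub = attach x y (single x)
      xy-conn : ConnSub G xy-sub
      xy-conn = attach-connected G-sym xy (∈-single x) (single-connected x)
      x∈xy : x ∈ᵥ xy-sub
      x∈xy = ∈-attach-old (∈-single x)
      v∉-attach : ∀ {s c} → c ∈ L → ¬ v ∈ᵥ s → ¬ v ∈ᵥ attach x c s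
      v∉-attach c∈ v∉ v∈ with ∈-attach⁻ v∈
      ... | inj₁ refl = v∉L c∈
      ... | inj₂ v∈s  = v∉ v∈s
      v∉xy : ¬ v ∈ᵥ xy-sub
      v∉xy = v∉-attach y∈L (v≢x ∘ ∈-single⁻)
      xy-no-xz : ¬ HasEdge xy-sub x z
      xy-no-xz e with edge-attach⁻ e
      ... | inj₁ (inj₁ (_ , eq))   = y≢z (sym eq)
      ... | inj₁ (inj₂ (refl , _)) = x∉L y∈L
      ... | inj₂ e′ = single-noEdge e′
      xy-Q : Q xy-sub
      xy-Q = (within-attach (there (there y∈L)) (within-single (there (here refl))) , edge-attach-new (inj₁ (refl , refl)))
           , ∈-attach-new , free-attach (λ _ _ → single-noEdge) , v∉xy , x∈xy

    pair-v : Family G (λ s → (K s × v ∈ᵥ s) × y ∈ᵥ s × NoEdgeIn L s) 2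
    pair-v = attachVertex G-sym xv (λ (_ , _ , _ , v∉ , x∈) → x∈ , v∉)
      (λ ((W , e) , y∈ , free , _) → ((within-attach (here refl) W , edge-attach-old e) , ∈-attach-new) ,
        ∈-attach-old y∈ , free-attach free)
      pair

    -- The edge xy, with xz and xv optional.
    four : Family G (λ s → K s × y ∈ᵥ s × NoEdgeIn L s) 4
    four = weaken (λ _ → [ (λ (κ , y∈ , free , _) → κ , y∈ , free) , (λ ((κ , _) , q) → κ , q) ]′)
      (merge (λ _ (_ , _ , _ , v∉ , _) ((_ , v∈) , _) → v∉ v∈) pair pair-v)

    2≤length : 2 ≤ length L
    2≤length = go path
      where
      go : ∀ {L} → Path G y z L → 2 ≤ length L
      go stop = contradiction refl y≢z
      go (cons _ _ stop) = s≤s (s≤s z≤n)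
      go (cons _ _ (cons _ _ _)) = s≤s (s≤s z≤n)

    sweep-four = sweep G-sym K proj₂ K-closed path four
    -- A second sweep from the two seeds containing `v`: as `L` has at least two vertices, it yields
    -- the four subgraphs through `v`.
    sweep-v = sweep G-sym (λ s → K s × v ∈ᵥ s) (proj₂ ∘ proj₁)
      (λ c∈ (κ , v∈) → K-closed c∈ κ , ∈-attach-old v∈) path pair-v

  anchored-base : Anchored G x y base
  anchored-base .amount = _
  anchored-base .anchors = proj₁ sweep-four
  -- Equality holds: the two vertices of `base` outside `L` account for the 8.
  anchored-base .count = ≤-reflexive (trans (*-distribˡ-+ 4 2 (length L))
    (trans (+-comm 8 (4 * length L)) (cong (_+ 8) (*-comm 4 (length L)))))
  anchored-base .through (here refl)         = shrink (*-monoˡ-≤ 2 2≤length) (proj₁ sweep-v)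
  -- Members of the last stage contain `x`, as an end of `xy`, and all of `L`.
  anchored-base .through (there (here refl)) = weaken (λ c (κ , _) → κ , c .edge-source (proj₂ κ)) (proj₂ sweep-four)
  anchored-base .through (there (there u∈))  = weaken (λ _ (κ , all) → κ , all u∈) (proj₂ sweep-four)

  -- The rest of the cycle: along `L` from `y` to `z`, which avoids `x`, and then `zx`, which
  -- differs from `xy` by `y≢z`.
  cycle-edge-detour : Walk (G ∖[ x , y ]) y x
  cycle-edge-detour = walk-++
    (path⇒walk (λ {a} {b} a∈ b∈ e → edge-∖ {A = G} {x} {y} {a} {b} e λ { (inj₁ (refl , _)) → x∉L a∈ ; (inj₂ (_ , refl)) → x∉L b∈ }) path)
    (step (edge-∖ {A = G} {x} {y} {z} {x} (trans (G-sym z x) xz) λ { (inj₁ (refl , _)) → x∉L z∈L ; (inj₂ (eq , _)) → y≢z (sym eq) }) here)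

anchored-count : ∀ {G : Graph n} → Symmetric G → Connected G → (T : Tadpole G) →
                 ∃ λ k → Family G (λ s → HasEdge s (Tadpole.x T) (Tadpole.y T)) k × 4 * n ≤ k + 8
anchored-count G-sym conn T
  with grow (Anchored _ _ _) conn (anchored-extend G-sym) (here refl) (base-unique G-sym T) (anchored-base G-sym T)
... | S , all , B = _ , weaken (λ _ → proj₂) (B .anchors) ,
  ≤-trans (*-monoʳ-≤ 4 (complete-Fin⇒length≥ all)) (B .count)

-- Two disjoint families: subgraphs containing `xy`, and those of the graph without `xy`, which
-- stays connected by the detour.
tadpole-bound : ∀ {G : Graph n} → Symmetric G → Connected G → Tadpole G →
                ∃ λ k → Family G (λ _ → ⊤) k × triangular n + 4 * n ≤ k + 8
tadpole-bound {n = n} {G} G-sym conn T with anchored-count G-sym conn T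
... | k , F , bound = _ , weaken _ (merge (λ _ ¬e e → ¬e e) (forget tree) F) ,
  ≤-trans (+-monoʳ-≤ (triangular n) bound) (≤-reflexive (sym (+-assoc (triangular n) k 8)))
  where
  open Tadpole T
  tree : Family (G ∖[ x , y ]) (λ _ → ⊤) (triangular n)
  tree = connected⇒triangular x (∖-symmetric {A = G} G-sym) (∖-connected G-sym conn (cycle-edge-detour G-sym T))
  forget : ∀ {k} → Family (G ∖[ x , y ]) (λ _ → ⊤) k → Family G (λ s → ¬ HasEdge s x y) k
  forget F = record { Family F using (members; unique; size) ; member = λ s∈ → connSub-∖ (proj₁ (F .member s∈)) }

-- Removing a pendant vertex from a connected subgraph

module Pendant {A : Adj n} {d c : Fin n} (c≢d : c ≢ d) {s : Sub n} (conn : ConnSub A s) (c∈ : c ∈ᵥ s)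
               (only-d : ∀ {w} → HasEdge s c w → w ≡ d) where

  -- A walk from `c` to another vertex would have to leave `c` along `cd`.
  isolated : ¬ HasEdge s c d → s ≡ single c
  isolated ¬cd = sub-ext (λ u∈ → subst (_∈ᵥ _) (sym (only-c u∈)) (∈-single c))
    (λ u∈ → subst (_∈ᵥ _) (sym (∈-single⁻ u∈)) c∈) (⊥-elim ∘ no-edge) (⊥-elim ∘ single-noEdge)
    where
    no-edge-c : ∀ {w} → ¬ HasEdge s c w
    no-edge-c e = ¬cd (subst (HasEdge s c) (only-d e) e)
    only-c : ∀ {u} → u ∈ᵥ s → u ≡ c
    only-c u∈ with conn .walks c∈ u∈
    ... | here     = refl
    ... | step e _ = contradiction (edge e) no-edge-c
    no-edge : ∀ {a b} → ¬ HasEdge s a b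
    no-edge e = no-edge-c (subst (λ a → HasEdge s a _) (only-c (conn .edge-source e)) e)

  detach : Sub n
  detach = tabulate (λ a → not (does (a ≟ c)) ∧ lookup (proj₁ s) a) , proj₂ s ∖[ d , c ]

  ∈-detach⁻ : ∀ {a} → a ∈ᵥ detach → a ≢ c × a ∈ᵥ s
  ∈-detach⁻ {a} (vertex p) with ∧-true⁻ (trans (sym (lookup∘tabulate _ a)) p)
  ... | q , r = (λ a≡c → contradiction (trans (sym q) (cong not (dec-true (a ≟ c) a≡c))) λ ()) , vertex r

  ∈-detach : ∀ {a} → a ≢ c → a ∈ᵥ s → a ∈ᵥ detach
  ∈-detach {a} a≢c (vertex p) =
    vertex (trans (lookup∘tabulate _ a) (∧-true (cong not (dec-false (a ≟ c) a≢c)) p))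

  edge-detach⁻ : ∀ {a b} → HasEdge detach a b → HasEdge s a b × ¬ Joins d c a b
  edge-detach⁻ {a} {b} (edge e) with edge-∖⁻ {A = proj₂ s} a b e
  ... | p , ¬j = edge p , ¬j

  edge-detach : ∀ {a b} → HasEdge s a b → ¬ Joins d c a b → HasEdge detach a b
  edge-detach {a} {b} (edge e) ¬j = edge (edge-∖ {A = proj₂ s} {d} {c} {a} {b} e ¬j)

  edge-detach-≢ : ∀ {a b} → HasEdge s a b → a ≢ c → b ≢ c → HasEdge detach a b
  edge-detach-≢ e a≢c b≢c = edge-detach e λ { (inj₁ (_ , b≡c)) → b≢c b≡c ; (inj₂ (a≡c , _)) → a≢c a≡c }

  -- A walk entering `c` comes from `d` and can only return to `d`, so the excursion is cut out;
  -- `bounce` handles the return.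
  prune  : ∀ {u v} → Walk (proj₂ s) u v → u ≢ c → v ≢ c → Walk (proj₂ detach) u v
  bounce : ∀ {v} → Walk (proj₂ s) c v → v ≢ c → Walk (proj₂ detach) d v

  prune here _ _ = here
  prune (step {w = w} e p) u≢c v≢c with w ≟ c
  ... | no w≢c   = step (isEdge (edge-detach-≢ (edge e) u≢c w≢c)) (prune p w≢c v≢c)
  ... | yes refl = subst (λ u → Walk _ u _) (sym (only-d (conn .edge-sym (edge e)))) (bounce p v≢c)

  bounce here v≢c = contradiction refl v≢c
  bounce (step e p) v≢c with only-d (edge e)
  ... | refl = prune p (c≢d ∘ sym) v≢c

  module _ (cd : HasEdge s c d) where

    d∈detach : d ∈ᵥ detach
    d∈detach = ∈-detach (c≢d ∘ sym) (edge-target conn cd)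

    detach-connected : ConnSub A detach
    detach-connected = record
      { edge-sym    = λ e → edge-detach (conn .edge-sym (proj₁ (edge-detach⁻ e))) (proj₂ (edge-detach⁻ e) ∘ joins-sym)
      ; edge-⊆      = conn .edge-⊆ ∘ proj₁ ∘ edge-detach⁻
      ; edge-source = λ e → ∈-detach
          (λ { refl → proj₂ (edge-detach⁻ e) (inj₂ (refl , only-d (proj₁ (edge-detach⁻ e)))) })
          (conn .edge-source (proj₁ (edge-detach⁻ e)))
      ; nonempty    = d , d∈detach
      ; walks       = λ u∈ v∈ → prune (conn .walks (proj₂ (∈-detach⁻ u∈)) (proj₂ (∈-detach⁻ v∈)))
          (proj₁ (∈-detach⁻ u∈)) (proj₁ (∈-detach⁻ v∈))
      }

    -- Together with `isolated` this makes the list `new` of the lollipop enumeration complete.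
    attach-detach : s ≡ attach d c detach
    attach-detach = sub-ext V⊆ V⊇ E⊆ E⊇
      where
      V⊆ : ∀ {a} → a ∈ᵥ s → a ∈ᵥ attach d c detach
      V⊆ {a} a∈ with a ≟ c
      ... | yes refl = ∈-attach-new
      ... | no a≢c   = ∈-attach-old (∈-detach a≢c a∈)
      V⊇ : ∀ {a} → a ∈ᵥ attach d c detach → a ∈ᵥ s
      V⊇ a∈ with ∈-attach⁻ a∈
      ... | inj₁ refl = c∈
      ... | inj₂ a∈′  = proj₂ (∈-detach⁻ a∈′)
      E⊆ : ∀ {a b} → HasEdge s a b → HasEdge (attach d c detach) a b
      E⊆ {a} {b} e with joins? d c a b
      ... | yes j = edge-attach-new j
      ... | no ¬j = edge-attach-old (edge-detach e ¬j)
      E⊇ : ∀ {a b} → HasEdge (attach d c detach) a b → HasEdge s a b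
      E⊇ e with edge-attach⁻ e
      ... | inj₁ (inj₁ (refl , refl)) = conn .edge-sym cd
      ... | inj₁ (inj₂ (refl , refl)) = cd
      ... | inj₂ e′ = proj₁ (edge-detach⁻ e′)

-- The lollipop

==⇒≡ : ∀ a b → (a == b) ≡ true → a ≡ b
==⇒≡ zero    zero    _ = refl
==⇒≡ (suc a) (suc b) p = cong suc (==⇒≡ a b p)

-- Beyond the triangle only path edges remain, and `w ≤ 3 + j` rules out the forward one.
lolAdj-backwards : ∀ j w → w ≤ 3 + j → lolAdj (3 + j) w ≡ true → w ≡ 2 + j
lolAdj-backwards j w w≤ e with ∨-true⁻ {pathStep (3 + j) w} e
... | inj₁ p = contradiction w≤ (subst (λ w → ¬ w ≤ 3 + j)
                 (sym (==⇒≡ w (4 + j) (proj₁ (∧-true⁻ p)))) 1+n≰n)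
... | inj₂ p = sym (==⇒≡ (2 + j) w (proj₁ (∧-true⁻ p)))

UpTo : Fin n → Sub n → Set
UpTo d s = ∀ {u} → u ∈ᵥ s → toℕ u ≤ toℕ d

-- Complete lists bound the number of subgraphs from above. On the first h = `suc (toℕ d)` vertices
-- the lengths are h(h+1)/2 + 4h - 8 and, through the last of them, h + 4; the second is the
-- increment's source.
record Enumeration (n : ℕ) (d : Fin n) : Set where
  field
    subs        : List (Sub n)
    subs-all    : ∀ {s} → ConnSub (lollipop n) s → UpTo d s → s ∈ subs
    subs-length : length subs + 8 ≡ triangular (suc (toℕ d)) + 4 * suc (toℕ d)
    ends        : List (Sub n)
    ends-all    : ∀ {s} → ConnSub (lollipop n) s → UpTo d s → d ∈ᵥ s → s ∈ ends
    ends-length : length ends ≡ toℕ d + 5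

open Enumeration

extend-count : ∀ a e j t → a + 8 ≡ t + 4 * suc j → e ≡ j + 5 →
               (suc e + a) + 8 ≡ (suc (suc j) + t) + 4 * suc (suc j)
extend-count a _ j t eq refl = trans (+-assoc (suc (j + 5)) a 8) (trans (cong (suc (j + 5) +_) eq) (lemma j t))
  where
  lemma : ∀ j t → suc (j + 5) + (t + 4 * suc j) ≡ (suc (suc j) + t) + 4 * suc (suc j)
  lemma = solve-∀

enumeration-extend : ∀ {d c : Fin n} {j} → toℕ d ≡ 2 + j → toℕ c ≡ 3 + j → Enumeration n d → Enumeration n c
enumeration-extend {n = n} {d} {c} {j} d≡ c≡ R = R′
  where
  c≡1+d : toℕ c ≡ suc (toℕ d)
  c≡1+d = trans c≡ (cong suc (sym d≡))
  c≢d : c ≢ d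
  c≢d refl = 1+n≢n (sym c≡1+d)
  new : List (Sub n)
  new = single c ∷ map (attach d c) (R .ends)
  below : ∀ {u} → toℕ u ≤ toℕ c → u ≢ c → toℕ u ≤ toℕ d
  below u≤ u≢ = ≤-pred (subst (_ <_) c≡1+d (≤∧≢⇒< u≤ (u≢ ∘ toℕ-injective)))
  only-d : ∀ {s} → ConnSub (lollipop n) s → UpTo c s → ∀ {w} → HasEdge s c w → w ≡ d
  only-d conn ≤c {w} e = toℕ-injective (trans (lolAdj-backwards j (toℕ w)
      (subst (toℕ w ≤_) c≡ (≤c (edge-target conn e)))
      (trans (cong (λ i → lolAdj i (toℕ w)) (sym c≡)) (trans (sym (lookup-matrix _ c w)) (conn .edge-⊆ e))))
    (sym d≡))
  new-all : ∀ {s} → ConnSub (lollipop n) s → UpTo c s → c ∈ᵥ s → s ∈ new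
  -- The edge `cd` decides between the two shapes in `new`.
  new-all {s} conn ≤c c∈ with proj₂ s [ c , d ] in eq
  ... | false = here (isolated λ (edge e) → contradiction (trans (sym eq) e) λ ())
    where open Pendant c≢d conn c∈ (only-d conn ≤c)
  ... | true  = there (subst (_∈ _) (sym (attach-detach (edge eq))) (∈-map⁺ (attach d c)
      (R .ends-all (detach-connected (edge eq))
        (λ u∈ → below (≤c (proj₂ (∈-detach⁻ u∈))) (proj₁ (∈-detach⁻ u∈))) (d∈detach (edge eq)))))
    where open Pendant c≢d conn c∈ (only-d conn ≤c)
  R′ : Enumeration n c
  R′ .ends        = new
  R′ .ends-all    = new-all
  R′ .ends-length = trans (cong suc (trans (length-map (attach d c) (R .ends)) (R .ends-length)))
                      (cong (_+ 5) (sym c≡1+d))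
  R′ .subs        = new ++ R .subs
  R′ .subs-all {s} conn ≤c with lookup (proj₁ s) c in eq
  ... | true  = ∈-++⁺ˡ (new-all conn ≤c (vertex eq))
  ... | false = ∈-++⁺ʳ new (R .subs-all conn λ u∈ → below (≤c u∈)
                  λ { refl → contradiction (trans (sym eq) (isVertex u∈)) λ () })
  R′ .subs-length = trans (cong (_+ 8) (length-++ new))
    (trans (extend-count (length (R .subs)) _ (toℕ d) (triangular (suc (toℕ d))) (R .subs-length)
             (trans (length-map (attach d c) (R .ends)) (R .ends-length)))
      (cong (λ i → triangular (suc i) + 4 * suc i) (sym c≡1+d)))

-- Subgraphs of the triangle, coded by their three vertex bits and the edge bits 01, 02, 12.

pattern 3+ i = suc (suc (suc i))

Code : Set
Code = Vec Bool 6

module _ {m : ℕ} where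

  codeVertex : Code → Fin (3 + m) → Bool
  codeVertex (a ∷ b ∷ c ∷ _) 0F     = a
  codeVertex (a ∷ b ∷ c ∷ _) 1F     = b
  codeVertex (a ∷ b ∷ c ∷ _) 2F     = c
  codeVertex (a ∷ b ∷ c ∷ _) (3+ _) = false

  codeEdge : Code → Fin (3 + m) → Fin (3 + m) → Bool
  codeEdge (_ ∷ _ ∷ _ ∷ p ∷ q ∷ r ∷ []) 0F 1F = p
  codeEdge (_ ∷ _ ∷ _ ∷ p ∷ q ∷ r ∷ []) 1F 0F = p
  codeEdge (_ ∷ _ ∷ _ ∷ p ∷ q ∷ r ∷ []) 0F 2F = q
  codeEdge (_ ∷ _ ∷ _ ∷ p ∷ q ∷ r ∷ []) 2F 0F = q
  codeEdge (_ ∷ _ ∷ _ ∷ p ∷ q ∷ r ∷ []) 1F 2F = r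
  codeEdge (_ ∷ _ ∷ _ ∷ p ∷ q ∷ r ∷ []) 2F 1F = r
  codeEdge _ _ _ = false

  decode : Code → Sub (3 + m)
  decode κ = tabulate (codeVertex κ) , tabulate λ a → tabulate (codeEdge κ a)

  encode : Sub (3 + m) → Code
  encode (V , E) = lookup V 0F ∷ lookup V 1F ∷ lookup V 2F ∷ E [ 0F , 1F ] ∷ E [ 0F , 2F ] ∷ E [ 1F , 2F ] ∷ []

_⇒_ : Bool → Bool → Bool
a ⇒ b = not a ∨ b

⇒-true : ∀ {a b} → (a ≡ true → b ≡ true) → (a ⇒ b) ≡ true
⇒-true {true}  f = f refl
⇒-true {false} f = refl

infixr 5 _⇒_

-- For three vertices, connectedness only says that no vertex is isolated when another one is present.
admissible : Code → Bool
admissible (a ∷ b ∷ c ∷ p ∷ q ∷ r ∷ []) =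
  (a ∨ b ∨ c)
  ∧ (p ⇒ a) ∧ (p ⇒ b) ∧ (q ⇒ a) ∧ (q ⇒ c) ∧ (r ⇒ b) ∧ (r ⇒ c)
  ∧ (a ⇒ b ⇒ p ∨ q) ∧ (a ⇒ c ⇒ p ∨ q)
  ∧ (b ⇒ a ⇒ p ∨ r) ∧ (b ⇒ c ⇒ p ∨ r)
  ∧ (c ⇒ a ⇒ q ∨ r) ∧ (c ⇒ b ⇒ q ∨ r)

codes : (k : ℕ) → List (Vec Bool k)
codes zero    = [] ∷ []
codes (suc k) = map (true ∷_) (codes k) ++ map (false ∷_) (codes k)

∈-codes : (v : Vec Bool k) → v ∈ codes k
∈-codes [] = here refl
∈-codes {suc k} (true ∷ v)  = ∈-++⁺ˡ (∈-map⁺ (true ∷_) (∈-codes v))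
∈-codes {suc k} (false ∷ v) = ∈-++⁺ʳ (map (true ∷_) (codes k)) (∈-map⁺ (false ∷_) (∈-codes v))

module Triangle {m : ℕ} {s : Sub (3 + m)} (conn : ConnSub (lollipop (3 + m)) s) (≤2 : UpTo 2F s) where

  private
    outside : ∀ {i} → ¬ 3+ i ∈ᵥ s
    outside u∈ with ≤2 u∈
    ... | s≤s (s≤s ())

    vertex-code : ∀ u → lookup (proj₁ s) u ≡ codeVertex (encode s) u
    vertex-code 0F     = refl
    vertex-code 1F     = refl
    vertex-code 2F     = refl
    vertex-code (3+ i) = ¬-not (outside ∘ vertex)

    loop : ∀ {u} → lollipop (3 + m) [ u , u ] ≡ false → proj₂ s [ u , u ] ≡ false
    loop eq = ¬-not λ e → contradiction (trans (sym eq) (conn .edge-⊆ (edge e))) λ ()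

    flip : ∀ u v → proj₂ s [ u , v ] ≡ proj₂ s [ v , u ]
    flip u v = ⇔⇒≡ (isEdge ∘ conn .edge-sym ∘ edge) (isEdge ∘ conn .edge-sym ∘ edge)

    edge-code : ∀ u v → proj₂ s [ u , v ] ≡ codeEdge (encode s) u v
    edge-code 0F 0F = loop {0F} refl
    edge-code 0F 1F = refl
    edge-code 0F 2F = refl
    edge-code 1F 0F = flip 1F 0F
    edge-code 1F 1F = loop {1F} refl
    edge-code 1F 2F = refl
    edge-code 2F 0F = flip 2F 0F
    edge-code 2F 1F = flip 2F 1F
    edge-code 2F 2F = loop {2F} refl
    edge-code 0F (3+ j) = ¬-not (outside ∘ edge-target conn ∘ edge)
    edge-code 1F (3+ j) = ¬-not (outside ∘ edge-target conn ∘ edge)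
    edge-code 2F (3+ j) = ¬-not (outside ∘ edge-target conn ∘ edge)
    edge-code (3+ i) v  = ¬-not (outside ∘ conn .edge-source ∘ edge)

    some-vertex : lookup (proj₁ s) 0F ∨ lookup (proj₁ s) 1F ∨ lookup (proj₁ s) 2F ≡ true
    some-vertex with conn .nonempty
    ... | 0F , vertex p   = ∨-trueˡ p
    ... | 1F , vertex p   = ∨-trueʳ {lookup (proj₁ s) 0F} (∨-trueˡ p)
    ... | 2F , vertex p   = ∨-trueʳ {lookup (proj₁ s) 0F} (∨-trueʳ p)
    ... | 3+ i , u∈ = contradiction u∈ outside

    -- Here connectedness enters the code: a walk to a different vertex has a first edge, and that
    -- edge is recorded in the code.
    leaves : ∀ u v → u ≢ v → lookup (proj₁ s) u ≡ true → lookup (proj₁ s) v ≡ true →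
             ∃ λ w → codeEdge (encode s) u w ≡ true
    leaves u v u≢v u∈ v∈ with conn .walks (vertex {u = u} u∈) (vertex {u = v} v∈)
    ... | here = contradiction refl u≢v
    ... | step {w = w} e _ = w , trans (sym (edge-code u w)) e

    leaves-0 : ∀ v → 0F ≢ v → lookup (proj₁ s) 0F ≡ true → lookup (proj₁ s) v ≡ true →
               proj₂ s [ 0F , 1F ] ∨ proj₂ s [ 0F , 2F ] ≡ true
    leaves-0 v ≢v u∈ v∈ with leaves 0F v ≢v u∈ v∈
    ... | 1F , e = ∨-trueˡ e
    ... | 2F , e = ∨-trueʳ e

    leaves-1 : ∀ v → 1F ≢ v → lookup (proj₁ s) 1F ≡ true → lookup (proj₁ s) v ≡ true →
               proj₂ s [ 0F , 1F ] ∨ proj₂ s [ 1F , 2F ] ≡ true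
    leaves-1 v ≢v u∈ v∈ with leaves 1F v ≢v u∈ v∈
    ... | 0F , e = ∨-trueˡ e
    ... | 2F , e = ∨-trueʳ e

    leaves-2 : ∀ v → 2F ≢ v → lookup (proj₁ s) 2F ≡ true → lookup (proj₁ s) v ≡ true →
               proj₂ s [ 0F , 2F ] ∨ proj₂ s [ 1F , 2F ] ≡ true
    leaves-2 v ≢v u∈ v∈ with leaves 2F v ≢v u∈ v∈
    ... | 0F , e = ∨-trueˡ e
    ... | 1F , e = ∨-trueʳ e

    source : ∀ u v → (proj₂ s [ u , v ] ⇒ lookup (proj₁ s) u) ≡ true
    source u v = ⇒-true λ e → isVertex (conn .edge-source (edge {u = u} {v} e))

    target : ∀ u v → (proj₂ s [ u , v ] ⇒ lookup (proj₁ s) v) ≡ true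
    target u v = ⇒-true λ e → isVertex (edge-target conn (edge {u = u} {v} e))

  decode-encode : s ≡ decode (encode s)
  decode-encode = cong₂ _,_
    (lookup-ext λ u → trans (vertex-code u) (sym (lookup∘tabulate (codeVertex (encode s)) u)))
    (lookup-ext λ u → lookup-ext λ v → trans (edge-code u v) (sym (lookup-matrix (codeEdge (encode s)) u v)))

  encode-admissible : admissible (encode s) ≡ true
  encode-admissible =
    ∧-true some-vertex
    (∧-true (source 0F 1F) (∧-true (target 0F 1F)
    (∧-true (source 0F 2F) (∧-true (target 0F 2F)
    (∧-true (source 1F 2F) (∧-true (target 1F 2F)
    (∧-true (⇒-true λ u∈ → ⇒-true λ v∈ → leaves-0 1F (λ ()) u∈ v∈)
    (∧-true (⇒-true λ u∈ → ⇒-true λ v∈ → leaves-0 2F (λ ()) u∈ v∈)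
    (∧-true (⇒-true λ u∈ → ⇒-true λ v∈ → leaves-1 0F (λ ()) u∈ v∈)
    (∧-true (⇒-true λ u∈ → ⇒-true λ v∈ → leaves-1 2F (λ ()) u∈ v∈)
    (∧-true (⇒-true λ u∈ → ⇒-true λ v∈ → leaves-2 0F (λ ()) u∈ v∈)
            (⇒-true λ u∈ → ⇒-true λ v∈ → leaves-2 1F (λ ()) u∈ v∈))))))))))))

opaque

  triangle-codes : List Code
  triangle-codes = filter (λ κ → admissible κ ≟ᵇ true) (codes 6)

  ∈-triangle-codes : ∀ {κ} → admissible κ ≡ true → κ ∈ triangle-codes
  ∈-triangle-codes {κ} = ∈-filter⁺ (λ κ → admissible κ ≟ᵇ true) (∈-codes κ)

  -- By evaluation over all 64 codes: three vertices, three edges, three two-edge paths, one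
  -- triangle.
  length-triangle-codes : length triangle-codes ≡ 10
  length-triangle-codes = refl

  rooted-codes : List Code
  rooted-codes = filter (λ κ → lookup κ 2F ≟ᵇ true) triangle-codes

  ∈-rooted-codes : ∀ {κ} → admissible κ ≡ true → lookup κ 2F ≡ true → κ ∈ rooted-codes
  ∈-rooted-codes {κ} p = ∈-filter⁺ (λ κ → lookup κ 2F ≟ᵇ true) (∈-triangle-codes p)

  -- One vertex, two edges, three two-edge paths, one triangle.
  length-rooted-codes : length rooted-codes ≡ 7
  length-rooted-codes = refl

module _ {m : ℕ} where

  enumeration-triangle : Enumeration (3 + m) 2F
  enumeration-triangle .subs        = map decode triangle-codes
  enumeration-triangle .subs-all {s} conn ≤2 = subst (_∈ map decode triangle-codes) (sym decode-encode)
    (∈-map⁺ decode (∈-triangle-codes encode-admissible))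
    where open Triangle conn ≤2
  -- At three vertices the required equation is 10 + 8 = 6 + 12.
  enumeration-triangle .subs-length =
    cong (_+ 8) (trans (length-map decode triangle-codes) length-triangle-codes)
  enumeration-triangle .ends        = map decode rooted-codes
  enumeration-triangle .ends-all {s} conn ≤2 (vertex 2∈) = subst (_∈ map decode rooted-codes) (sym decode-encode)
    (∈-map⁺ decode (∈-rooted-codes encode-admissible 2∈))
    where open Triangle conn ≤2
  enumeration-triangle .ends-length = trans (length-map decode rooted-codes) length-rooted-codes

  enumeration : ∀ j (d : Fin (3 + m)) → toℕ d ≡ 2 + j → Enumeration (3 + m) d
  enumeration zero    d d≡ = subst (Enumeration (3 + m)) (toℕ-injective {j = d} (sym d≡)) enumeration-triangle
  enumeration (suc j) d d≡ = enumeration-extend c≡ d≡ (enumeration j c c≡)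
    where
    2+j<n : 2 + j < 3 + m
    2+j<n = ≤-trans (n≤1+n _) (subst (_< 3 + m) d≡ (toℕ<n d))
    c : Fin (3 + m)
    c = fromℕ< 2+j<n
    c≡ : toℕ c ≡ 2 + j
    c≡ = toℕ-fromℕ< 2+j<n

-- Comparison of the core indices

coreIndex-≥ : ∀ {G : Graph n} {a} → IsSimple G → Connected G → ExactlyOnePendant G → CoreIndex G a →
              triangular n + 4 * n ≤ a + 8
coreIndex-≥ {n = n} {G} simple conn pendant (K , _ , K-all , refl) =
  conclude (tadpole-bound (proj₁ simple) conn (tadpole simple pendant))
  where
  conclude : (∃ λ k → Family G (λ _ → ⊤) k × triangular n + 4 * n ≤ k + 8) →
             triangular n + 4 * n ≤ length K + 8
  conclude (k , F , bound) = ≤-trans bound (+-monoˡ-≤ 8 (≤-trans (F .size) (unique-⊆⇒length≤ (F .unique)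
    λ {s} s∈ → Equivalence.from (K-all s) (fromConnSub (proj₁ (F .member s∈))))))

coreIndex-lollipop-≤ : ∀ m {b} → CoreIndex (lollipop (3 + m)) b → b + 8 ≤ triangular (3 + m) + 4 * (3 + m)
coreIndex-lollipop-≤ m (M , M-unique , M-all , refl) = begin
  length M + 8                                     ≤⟨ +-monoˡ-≤ 8 (unique-⊆⇒length≤ M-unique M⊆) ⟩
  length (E .subs) + 8                             ≡⟨ E .subs-length ⟩
  triangular (suc (toℕ last)) + 4 * suc (toℕ last) ≡⟨ cong (λ i → triangular (suc i) + 4 * suc i) last≡ ⟩
  triangular (3 + m) + 4 * (3 + m)                 ∎
  where
  open ≤-Reasoning
  last : Fin (3 + m)
  last = fromℕ (2 + m)
  last≡ : toℕ last ≡ 2 + m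
  last≡ = toℕ-fromℕ (2 + m)
  E : Enumeration (3 + m) last
  E = enumeration m last last≡
  M⊆ : ∀ {s} → s ∈ M → s ∈ E .subs
  M⊆ {s} s∈ = E .subs-all (toConnSub (Equivalence.to (M-all s) s∈))
    λ {u} _ → ≤-trans (toℕ≤pred[n] u) (≤-reflexive (sym last≡))

theorem5p6 : (n : ℕ) → 4 ≤ n → (G : Graph n) → IsSimple G → Connected G →
    ExactlyOnePendant G → (a b : ℕ) → CoreIndex G a → CoreIndex (lollipop n) b → b ≤ a
theorem5p6 (suc (suc (suc m))) (s≤s (s≤s (s≤s _))) G simple conn pendant a b core-G core-lollipop =
  -- Both core indices, increased by 8, are compared with n(n+1)/2 + 4n.
  +-cancelʳ-≤ 8 b a (≤-trans (coreIndex-lollipop-≤ m core-lollipop) (coreIndex-≥ simple conn pendant core-G))
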